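{- Let $f\colon\{0,1\}^n\to\{0,1\}$ be a total function with $f^{ -1}(0)\neq\emptyset$. Then there exist a partial function $g\colon\{0,1\}^{2n}\to\{0,1,*\}$ and an input $z\in g^{ -1}(*)$ such that \[ \min\{\mathrm{C}_{\bar 0}(g,z),\,\mathrm{C}_{\bar 1}(g,z)\}\;\ge\;\mathrm{C}_0(f)\qquad\text{and}\qquad\mathrm{C}(g)\;\le\;2\,\mathrm{UC}_1(f). \]
   Context: For a partial function $f\colon\{0,1\}^n\to\{0,1,*\}$: a partial input $\rho\in\{0,1,*\}^n$ is consistent with $x\in\{0,1\}^n$ if $\rho_i=x_i$ whenever $\rho_i\neq*$; its size $|\rho|$ is the number of non-$*$ entries. For $\Sigma\subseteq\{0,1,*\}$, $\rho$ is a $\Sigma$-certificate for $x$ if $\rho$ is consistent with $x$ and $f(x')\in\Sigma$ for all $x'$ consistent with $\rho$. $\mathrm{C}_\Sigma(f,x)$ is the least size of a $\Sigma$-certificate for $x$, and $\mathrm{C}_\Sigma(f)=\max_{x\in f^{ -1}(\Sigma)}\mathrm{C}_\Sigma(f,x)$. We write $0,1,\bar0,\bar1$ for $\Sigma=\{0\},\{1\},\{1,*\},\{0,*\}$, and $\mathrm{C}(f)=\max\{\mathrm{C}_0(f),\mathrm{C}_1(f)\}$. For total $f$, $\mathrm{C}_0(f)$ is the least $k$ such that $f$ is a width-$k$ CNF, and $\mathrm{UC}_1(f)$ is the least $k$ such that $f$ can be written as an unambiguous width-$k$ DNF (every input satisfies at most one term; width = maximum number of literals in a term). -}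

module Defs where

open import Data.Bool using (Bool; true; false)
import Data.Bool.Properties as Bool
open import Data.Fin using (Fin)
open import Data.Fin.Properties using () renaming (all? to allFin?)
open import Data.List using (List; []; _∷_; _++_; map; filter; length; allFin;
  cartesianProduct; cartesianProductWith)
open import Data.List.Extrema.Nat using (min; max)
open import Data.List.Relation.Unary.All using (All; all?)
open import Data.List.Relation.Unary.Any using (any?)
open import Data.Maybe using (Maybe; just; nothing)
import Data.Maybe.Properties as Maybe
open import Data.Nat using (ℕ; zero; suc; _≤_; _≤?_; _⊔_)
open import Data.Product using (_×_; _,_)
open import Data.Vec using (Vec; []; _∷_; lookup; count)
open import Function using (_∘_)
open import Relation.Binary.Definitions using (DecidableEquality)
open import Relation.Binary.PropositionalEquality using (_≡_; _≢_)
open import Relation.Nullary using (Dec; does)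
open import Relation.Nullary.Decidable using (map′; ¬?; _×-dec_; _→-dec_)
open import Relation.Unary using (Decidable)

-- The alphabet {0,1,*} is Maybe Bool, with * = nothing.
_≟*_ : DecidableEquality (Maybe Bool)
_≟*_ = Maybe.≡-dec Bool._≟_

open import Data.List.Membership.DecPropositional _≟*_ using (_∈_; _∈?_)

Input : ℕ → Set
Input n = Vec Bool n

TotalFn : ℕ → Set
TotalFn n = Input n → Bool

PartialFn : ℕ → Set
PartialFn n = Input n → Maybe Bool

PartialInput : ℕ → Set
PartialInput n = Vec (Maybe Bool) n

toPartial : ∀ {n} → TotalFn n → PartialFn n
toPartial f = just ∘ f

allVecs : ∀ {A : Set} → List A → ∀ n → List (Vec A n)
allVecs as zero    = [] ∷ []
allVecs as (suc n) = cartesianProductWith _∷_ as (allVecs as n)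

allInputs : ∀ n → List (Input n)
allInputs = allVecs (false ∷ true ∷ [])

allPartialInputs : ∀ n → List (PartialInput n)
allPartialInputs = allVecs (nothing ∷ just false ∷ just true ∷ [])

allInput? : ∀ {n} {P : Input n → Set} → Decidable P → Dec (∀ x → P x)
allInput? {zero}  P? = map′ (λ { p [] → p }) (λ h → h []) (P? [])
allInput? {suc n} P? =
  map′ (λ { (p , q) (false ∷ x) → p x ; (p , q) (true ∷ x) → q x })
       (λ h → h ∘ (false ∷_) , h ∘ (true ∷_))
       (allInput? (P? ∘ (false ∷_)) ×-dec allInput? (P? ∘ (true ∷_)))

Consistent : ∀ {n} → PartialInput n → Input n → Set
Consistent ρ x = ∀ i → lookup ρ i ≢ nothing → lookup ρ i ≡ just (lookup x i)

consistent? : ∀ {n} (ρ : PartialInput n) → Decidable (Consistent ρ)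
consistent? ρ x = allFin? λ i →
  ¬? (lookup ρ i ≟* nothing) →-dec (lookup ρ i ≟* just (lookup x i))

size : ∀ {n} → PartialInput n → ℕ
size = count (λ s → ¬? (s ≟* nothing))

-- A subset of {0,1,*} is given by a list of its elements.
Symbols : Set
Symbols = List (Maybe Bool)

⟨0⟩ ⟨1⟩ ⟨not0⟩ ⟨not1⟩ : Symbols
⟨0⟩    = just false ∷ []
⟨1⟩    = just true ∷ []
⟨not0⟩ = just true ∷ nothing ∷ []
⟨not1⟩ = just false ∷ nothing ∷ []

Certificate : ∀ {n} → Symbols → PartialFn n → Input n → PartialInput n → Set
Certificate S f x ρ = Consistent ρ x × (∀ x′ → Consistent ρ x′ → f x′ ∈ S)

certificate? : ∀ {n} S (f : PartialFn n) x → Decidable (Certificate S f x)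
certificate? S f x ρ = consistent? ρ x ×-dec
  allInput? (λ x′ → consistent? ρ x′ →-dec (f x′ ∈? S))

-- C_S(f,x), meaningful for x ∈ f⁻¹(S).  There the fully specified input x is
-- itself a certificate, of size n, so the bound n passed to min is attained by
-- an actual certificate.
C-at : ∀ {n} → Symbols → PartialFn n → Input n → ℕ
C-at {n} S f x = min n (map size (filter (certificate? S f x) (allPartialInputs n)))

-- The maximum over an empty preimage is 0.
C-on : ∀ {n} → Symbols → PartialFn n → ℕ
C-on {n} S f = max 0 (map (C-at S f) (filter (λ x → f x ∈? S) (allInputs n)))

C : ∀ {n} → PartialFn n → ℕ
C f = C-on ⟨0⟩ f ⊔ C-on ⟨1⟩ f

-- (i , true) is the literal xᵢ and (i , false) its negation.
Literal : ℕ → Set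
Literal n = Fin n × Bool

Term : ℕ → Set
Term n = List (Literal n)

DNF : ℕ → Set
DNF n = List (Term n)

Satisfies : ∀ {n} → Input n → Term n → Set
Satisfies x = All (λ { (i , b) → lookup x i ≡ b })

satisfies? : ∀ {n} (x : Input n) → Decidable (Satisfies x)
satisfies? x = all? (λ { (i , b) → lookup x i Bool.≟ b })

evalDNF : ∀ {n} → DNF n → TotalFn n
evalDNF D x = does (any? (satisfies? x) D)

width : ∀ {n} → DNF n → ℕ
width D = max 0 (map length D)

Unambiguous : ∀ {n} → DNF n → Set
Unambiguous D = ∀ x → length (filter (satisfies? x) D) ≤ 1

UnambiguousDNFOf : ∀ {n} → TotalFn n → DNF n → Set
UnambiguousDNFOf f D = Unambiguous D × (∀ x → evalDNF D x ≡ f x)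

unambiguousDNFOf? : ∀ {n} (f : TotalFn n) → Decidable (UnambiguousDNFOf f)
unambiguousDNFOf? f D =
  allInput? (λ x → length (filter (satisfies? x) D) ≤? 1) ×-dec
  allInput? (λ x → evalDNF D x Bool.≟ f x)

subsets : ∀ {A : Set} → List A → List (List A)
subsets []       = [] ∷ []
subsets (a ∷ as) = subsets as ++ map (a ∷_) (subsets as)

-- All DNFs up to order and repetition: a term is a set of literals, and a DNF
-- is a set of terms.
allDNFs : ∀ n → List (DNF n)
allDNFs n = subsets (subsets (cartesianProduct (allFin n) (false ∷ true ∷ [])))

-- The least width of an unambiguous DNF of f.  The bound n passed to min is
-- harmless: the DNF with one full-length term for each x ∈ f⁻¹(1) is
-- unambiguous and has width at most n.
UC₁ : ∀ {n} → TotalFn n → ℕ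
UC₁ {n} f = min n (map width (filter (unambiguousDNFOf? f) (allDNFs n)))

{-# OPTIONS --safe #-}
-- Choose for every x ∈ f⁻¹(1) its term T(x) in an unambiguous DNF of f, and let
-- g(x,b) be * if f(x) = 0 and the OR of the bits bᵢ over the variables i of T(x)
-- otherwise.  The variables of T(x), read in both x and b, certify g(x,b).  Let
-- z = (x₀,0) where x₀ ∈ f⁻¹(0) is hardest to certify.  If fewer than C₀(f)
-- positions of z are fixed, then some x ∈ f⁻¹(1) agrees with x₀ on all the touched
-- indices; b = 0 gives g(x,b) = 0, and since x₀ violates T(x), some variable of
-- T(x) is untouched, so that b can be chosen with g(x,b) = 1.
module Submission where

open import Defs
open import Data.Bool using (Bool; true; false; if_then_else_; not)
open import Data.Bool.Properties using (not-injective)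
open import Data.Bool.ListAction using (any; or)
open import Data.Fin using (Fin; zero; suc; _↑ˡ_; _↑ʳ_; splitAt)
open import Data.Fin.Properties using (join-splitAt) renaming (_≟_ to _≟ᶠ_)
open import Data.List using (List; []; _∷_; _++_; map; filter; length; allFin; head)
open import Data.List.Extrema.Nat using (argmin-sel; argmax-sel; min≤⊤; min≤v⁺; v≤min⁺; max≤v⁺; xs≤max)
open import Data.List.Membership.Propositional using (_∈_; _∉_; find; lose)
open import Data.List.Membership.Propositional.Properties
  using (∈-map⁺; ∈-map⁻; ∈-filter⁺; ∈-filter⁻; ∈-cartesianProductWith⁺; ∈-allFin; ∈-++⁺ˡ; ∈-++⁺ʳ)
open import Data.List.Properties using (length-map; length-++; length-tabulate; map-cong-local)
open import Data.List.Relation.Unary.All as All using (All; []; _∷_)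
import Data.List.Relation.Unary.All.Properties as All
open import Data.List.Relation.Unary.Any using (here; there; any?)
open import Data.Maybe using (just; nothing; fromMaybe)
open import Data.Maybe.Properties using (just-injective)
open import Data.Nat using (ℕ; zero; suc; _+_; _*_; _≤_; _≥_; _⊓_; z≤n; s≤s)
open import Data.Nat.Properties
  using (≤-refl; ≤-reflexive; ≤-trans; m≤m+n; m≤n⇒m≤1+n; ⊓-glb; ⊔-lub; +-identityʳ; +-mono-≤; module ≤-Reasoning)
open import Data.Product using (_×_; _,_; proj₁; proj₂; ∃-syntax)
open import Data.Sum using (inj₁; inj₂; [_,_]′)
open import Data.Vec as Vec using (Vec; []; _∷_; lookup; replicate; tabulate; _[_]≔_)
open import Data.Vec.Properties
  using (lookup-replicate; lookup∘update; lookup∘update′; lookup∘tabulate; tabulate∘lookup; tabulate-cong;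
         lookup-++ˡ; lookup-++ʳ)
open import Function using (_∘_; id)
open import Relation.Binary.PropositionalEquality
  using (_≡_; _≢_; refl; sym; trans; cong; cong₂; subst; module ≡-Reasoning)
open import Relation.Nullary using (Dec; yes; no; does; contradiction)
open import Relation.Nullary.Decidable using (dec-true)

private variable
  A : Set
  n w : ℕ

-- Partial inputs and lists of positions.

allVecs-complete : ∀ {as : List A} → (∀ a → a ∈ as) → (v : Vec A n) → v ∈ allVecs as n
allVecs-complete all∈ []      = here refl
allVecs-complete all∈ (a ∷ v) = ∈-cartesianProductWith⁺ _∷_ (all∈ a) (allVecs-complete all∈ v)

∈-allPartialInputs : (ρ : PartialInput n) → ρ ∈ allPartialInputs n
∈-allPartialInputs = allVecs-complete λ
  { nothing → here refl ; (just false) → there (here refl) ; (just true) → there (there (here refl)) }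

AgreeOn : List (Fin n) → Input n → Input n → Set
AgreeOn vs x y = ∀ {i} → i ∈ vs → lookup y i ≡ lookup x i

lookup-ext : {x y : Vec A n} → (∀ i → lookup x i ≡ lookup y i) → x ≡ y
lookup-ext {x = x} {y} eq =
  trans (sym (tabulate∘lookup x)) (trans (tabulate-cong eq) (tabulate∘lookup y))

-- Repeated positions are overwritten with the same bit, so the size may fall below the length of
-- the list.
restrict : List (Fin n) → Input n → PartialInput n
restrict []       x = replicate _ nothing
restrict (v ∷ vs) x = restrict vs x [ v ]≔ just (lookup x v)

size-nothing : ∀ n → size (replicate n nothing) ≡ 0
size-nothing zero    = refl
size-nothing (suc n) = size-nothing n

size-update : (ρ : PartialInput n) (i : Fin n) {b : Bool} → size (ρ [ i ]≔ just b) ≤ suc (size ρ)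
size-update (nothing ∷ ρ) zero    = ≤-refl
size-update (just _ ∷ ρ)  zero    = m≤n⇒m≤1+n ≤-refl
size-update (nothing ∷ ρ) (suc i) = size-update ρ i
size-update (just _ ∷ ρ)  (suc i) = s≤s (size-update ρ i)

size-restrict : (vs : List (Fin n)) (x : Input n) → size (restrict vs x) ≤ length vs
size-restrict {n} []   x = ≤-reflexive (size-nothing n)
size-restrict (v ∷ vs) x = ≤-trans (size-update (restrict vs x) v) (s≤s (size-restrict vs x))

restrict-consistent : (vs : List (Fin n)) (x : Input n) → Consistent (restrict vs x) x
restrict-consistent []       x i ≢* = contradiction (lookup-replicate i nothing) ≢*
restrict-consistent (v ∷ vs) x i ≢* with i ≟ᶠ v
... | yes refl = lookup∘update v (restrict vs x) _
... | no i≢v   = trans eq (restrict-consistent vs x i (≢* ∘ trans eq))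
  where eq = lookup∘update′ i≢v (restrict vs x) (just (lookup x v))

lookup-restrict : (vs : List (Fin n)) (x : Input n) {i : Fin n} →
  i ∈ vs → lookup (restrict vs x) i ≡ just (lookup x i)
lookup-restrict (v ∷ vs) x {i} i∈ with i ≟ᶠ v | i∈
... | yes refl | _          = lookup∘update v (restrict vs x) _
... | no i≢v   | here i≡v   = contradiction i≡v i≢v
... | no i≢v   | there i∈vs = trans (lookup∘update′ i≢v (restrict vs x) _) (lookup-restrict vs x i∈vs)

consistent-restrict⇒AgreeOn : (vs : List (Fin n)) (x y : Input n) →
  Consistent (restrict vs x) y → AgreeOn vs x y
consistent-restrict⇒AgreeOn vs x y con {i} i∈
  with eq ← lookup-restrict vs x i∈ =
  just-injective (trans (sym (con i λ ≡* → contradiction (trans (sym eq) ≡*) λ ())) eq)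

support : PartialInput n → List (Fin n)
support []            = []
support (nothing ∷ ρ) = map suc (support ρ)
support (just _ ∷ ρ)  = zero ∷ map suc (support ρ)

length-support : (ρ : PartialInput n) → length (support ρ) ≡ size ρ
length-support []            = refl
length-support (nothing ∷ ρ) = trans (length-map suc (support ρ)) (length-support ρ)
length-support (just _ ∷ ρ)  = cong suc (trans (length-map suc (support ρ)) (length-support ρ))

∈-support : (ρ : PartialInput n) {i : Fin n} → lookup ρ i ≢ nothing → i ∈ support ρ
∈-support (nothing ∷ ρ) {zero}  ≢* = contradiction refl ≢*
∈-support (nothing ∷ ρ) {suc i} ≢* = ∈-map⁺ suc (∈-support ρ ≢*)
∈-support (just _ ∷ ρ)  {zero}  ≢* = here refl
∈-support (just _ ∷ ρ)  {suc i} ≢* = there (∈-map⁺ suc (∈-support ρ ≢*))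

-- Bounds on certificate complexity.

-- A certificate for `x` in the form of the positions it fixes; consistency with `x` forces their
-- values.
Determines : PartialFn n → Input n → Symbols → List (Fin n) → Set
Determines g x S vs = ∀ y → AgreeOn vs x y → g y ∈ S

C-at≤length : ∀ {S} (g : PartialFn n) x vs → Determines g x S vs → C-at S g x ≤ length vs
C-at≤length {n} {S} g x vs det = min≤v⁺ n _
  (inj₂ (lose (∈-map⁺ size (∈-filter⁺ (certificate? S g x) (∈-allPartialInputs (restrict vs x)) cert))
              (size-restrict vs x)))
  where
  cert : Certificate S g x (restrict vs x)
  cert = restrict-consistent vs x , λ y con → det y (consistent-restrict⇒AgreeOn vs x y con)

C-at≤arity : ∀ {S} (g : PartialFn n) x → C-at S g x ≤ n
C-at≤arity {n} {S} g x = min≤⊤ n (map size (filter (certificate? S g x) (allPartialInputs n)))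

-- The support of a certificate is a determining list as long as the certificate is large. The
-- hypothesis `k ≤ n` covers the default `n` of the minimum.
≤C-at : ∀ {S} (g : PartialFn n) x {k} → k ≤ n →
  (∀ vs → Determines g x S vs → k ≤ length vs) → k ≤ C-at S g x
≤C-at {S = S} g x {k} k≤n bound =
  v≤min⁺ k≤n (All.map⁺ (All.tabulate λ {ρ} ρ∈ →
    certified ρ (proj₂ (∈-filter⁻ (certificate? S g x) {xs = allPartialInputs _} ρ∈))))
  where
  certified : ∀ ρ → Certificate S g x ρ → k ≤ size ρ
  certified ρ (con , cert) = subst (k ≤_) (length-support ρ) (bound (support ρ) λ y agree →
    cert y λ i ≢* → trans (con i ≢*) (cong just (sym (agree (∈-support ρ ≢*)))))

C-on≤ : ∀ {S} (g : PartialFn n) {k} → (∀ x → g x ∈ S → C-at S g x ≤ k) → C-on S g ≤ k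
C-on≤ {n} {S} g bound = max≤v⁺ z≤n (All.map⁺ (All.tabulate λ {x} x∈ →
  bound x (proj₂ (∈-filter⁻ _ {xs = allInputs n} x∈))))

C-on-attained : ∀ {S} (g : PartialFn n) x → g x ∈ S → ∃[ y ] (g y ∈ S × C-on S g ≤ C-at S g y)
C-on-attained {n} {S} g x gx∈ with argmax-sel id 0 (map (C-at S g) (filter _ (allInputs n)))
-- The maximum is its default 0, so any point of the preimage will do; this is where nonemptiness
-- enters.
... | inj₁ ≡0 = x , gx∈ , ≤-trans (≤-reflexive ≡0) z≤n
... | inj₂ ∈map with y , y∈ , eq ← ∈-map⁻ (C-at S g) ∈map =
  y , proj₂ (∈-filter⁻ _ {xs = allInputs n} y∈) , ≤-reflexive eq

-- Terms of an unambiguous DNF.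

-- All that is needed of an unambiguous DNF of width at most w: the term it
-- assigns to each x ∈ f⁻¹(1).  The values of term outside f⁻¹(1) are irrelevant.
record UnambiguousTerms (f : TotalFn n) (w : ℕ) : Set where
  field
    term      : Input n → Term n
    satisfied : ∀ x → f x ≡ true → Satisfies x (term x)
    implies   : ∀ x y → f x ≡ true → Satisfies y (term x) → f y ≡ true
    unique    : ∀ x y → f x ≡ true → Satisfies y (term x) → term y ≡ term x
    short     : ∀ x → f x ≡ true → length (term x) ≤ w

does-true : (a? : Dec A) → does a? ≡ true → A
does-true (yes a) _ = a

head-unique : ∀ {a d : A} {as} → a ∈ as → length as ≤ 1 → fromMaybe d (head as) ≡ a
head-unique {as = _ ∷ []} (here a≡) _ = sym a≡
head-unique {as = _ ∷ _ ∷ _} _ (s≤s ())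

fromDNF : (f : TotalFn n) (D : DNF n) → UnambiguousDNFOf f D → UnambiguousTerms f (width D)
fromDNF {n} f D (unamb , computes) = record
  { term      = term
  ; satisfied = λ x fx → proj₂ (chosen x fx)
  ; implies   = λ x y fx sat → trans (sym (computes y))
      (dec-true (any? (satisfies? y) D) (lose (proj₁ (chosen x fx)) sat))
  ; unique    = λ x y fx sat → term-unique y (proj₁ (chosen x fx)) sat
  ; short     = λ x fx → All.lookup (xs≤max 0 (map length D)) (∈-map⁺ length (proj₁ (chosen x fx)))
  }
  where
  term : Input n → Term n
  -- The default `[]` arises only when no term is satisfied, that is, outside f⁻¹(1).
  term x = fromMaybe [] (head (filter (satisfies? x) D))

  term-unique : ∀ x {T} → T ∈ D → Satisfies x T → term x ≡ T
  term-unique x T∈ sat = head-unique (∈-filter⁺ (satisfies? x) T∈ sat) (unamb x)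

  chosen : ∀ x → f x ≡ true → term x ∈ D × Satisfies x (term x)
  chosen x fx
    with T , T∈ , sat ← find (does-true (any? (satisfies? x) D) (trans (computes x) fx)) =
    subst (λ T → T ∈ D × Satisfies x T) (sym (term-unique x T∈ sat)) (T∈ , sat)

-- For the case that the minimum defining UC₁ is only attained by its bound n.
fullTerms : (f : TotalFn n) → UnambiguousTerms f n
fullTerms {n} f = record
  { term      = full
  ; satisfied = λ _ _ → All.map⁺ (All.tabulate λ _ → refl)
  ; implies   = λ x y fx sat → trans (cong f (full-determines x y sat)) fx
  ; unique    = λ x y _ sat → cong full (full-determines x y sat)
  ; short     = λ _ _ → ≤-reflexive (trans (length-map _ (allFin n)) (length-tabulate id))
  }
  where
  full : Input n → Term n
  full x = map (λ i → i , lookup x i) (allFin n)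

  full-determines : ∀ x y → Satisfies y (full x) → y ≡ x
  full-determines x y sat = lookup-ext λ i → All.lookup (All.map⁻ sat) (∈-allFin i)

unambiguousTerms : (f : TotalFn n) → UnambiguousTerms f (UC₁ f)
unambiguousTerms {n} f with argmin-sel id n (map width (filter (unambiguousDNFOf? f) (allDNFs n)))
... | inj₁ ≡n = subst (UnambiguousTerms f) (sym ≡n) (fullTerms f)
... | inj₂ ∈map with D , D∈ , eq ← ∈-map⁻ width ∈map =
  subst (UnambiguousTerms f) (sym eq)
    (fromDNF f D (proj₂ (∈-filter⁻ (unambiguousDNFOf? f) {xs = allDNFs n} D∈)))

-- Disjunctions, and inputs split into two halves.

any-false⁺ : ∀ {p : A → Bool} {as} → All (λ a → p a ≡ false) as → any p as ≡ false
any-false⁺ []         = refl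
any-false⁺ (eq ∷ eqs) rewrite eq = any-false⁺ eqs

any-false⁻ : ∀ {p : A → Bool} as → any p as ≡ false → All (λ a → p a ≡ false) as
any-false⁻         []       _  = []
any-false⁻ {p = p} (a ∷ as) eq with p a in pa
... | false = pa ∷ any-false⁻ as eq

left right : Input (n + n) → Input n
left  {n} z = tabulate λ i → lookup z (i ↑ˡ n)
right {n} z = tabulate λ i → lookup z (n ↑ʳ i)

left-++ : (x b : Input n) → left (x Vec.++ b) ≡ x
left-++ x b = trans (tabulate-cong (lookup-++ˡ x b)) (tabulate∘lookup x)

right-++ : (x b : Input n) → right (x Vec.++ b) ≡ b
right-++ x b = trans (tabulate-cong (lookup-++ʳ x b)) (tabulate∘lookup b)

-- Forgets the half in which a position lies: the folded list collects the indices touched in x or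
-- in b and is no longer than the original.
fold : Fin (n + n) → Fin n
fold {n} = [ id , id ]′ ∘ splitAt n

++-agree : ∀ (x y b c : Input n) {ws} →
  AgreeOn (map fold ws) x y → AgreeOn (map fold ws) b c → AgreeOn ws (x Vec.++ b) (y Vec.++ c)
++-agree {n} x y b c agreeˡ agreeʳ {k} k∈
  -- Matching `join-splitAt` with `refl` rewrites `k` as an injected index `i`; abstracting the
  -- membership alongside lets its `fold` reduce to that `i`.
  with splitAt n k | join-splitAt n n k | ∈-map⁺ (fold {n}) k∈
... | inj₁ i | refl | i∈ = trans (lookup-++ˡ y c i) (trans (agreeˡ i∈) (sym (lookup-++ˡ x b i)))
... | inj₂ i | refl | i∈ = trans (lookup-++ʳ y c i) (trans (agreeʳ i∈) (sym (lookup-++ʳ x b i)))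

-- The function g and the upper bound on C(g).

module Construction (f : TotalFn n) (terms : UnambiguousTerms f w) where
  open UnambiguousTerms terms

  vars : Input n → List (Fin n)
  vars x = map proj₁ (term x)

  g : PartialFn (n + n)
  g z = if f (left z) then just (any (lookup (right z)) (vars (left z))) else nothing

  g-value : ∀ z → f (left z) ≡ true → g z ≡ just (any (lookup (right z)) (vars (left z)))
  g-value z eq rewrite eq = refl

  g-defined : ∀ z {c} → g z ≡ just c → f (left z) ≡ true
  g-defined z eq with f (left z)
  ... | true = refl

  g-++ : ∀ x b → f x ≡ true → g (x Vec.++ b) ≡ just (any (lookup b) (vars x))
  g-++ x b fx rewrite left-++ x b | right-++ x b | fx = refl

  satisfies-agree : ∀ x y → f x ≡ true → AgreeOn (vars x) x y → Satisfies y (term x)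
  satisfies-agree x y fx agree = All.tabulate λ l∈ →
    trans (agree (∈-map⁺ proj₁ l∈)) (All.lookup (satisfied x fx) l∈)

  readVars : Input n → List (Fin (n + n))
  readVars x = map (_↑ˡ n) (vars x) ++ map (n ↑ʳ_) (vars x)

  length-readVars : ∀ x → f x ≡ true → length (readVars x) ≤ w + w
  length-readVars x fx = begin
    length (readVars x)
      ≡⟨ length-++ (map (_↑ˡ n) (vars x)) ⟩
    length (map (_↑ˡ n) (vars x)) + length (map (n ↑ʳ_) (vars x))
      ≡⟨ cong₂ _+_ (length-map (_↑ˡ n) (vars x)) (length-map (n ↑ʳ_) (vars x)) ⟩
    length (vars x) + length (vars x)
      ≡⟨ cong₂ _+_ (length-map proj₁ (term x)) (length-map proj₁ (term x)) ⟩
    length (term x) + length (term x)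
      ≤⟨ +-mono-≤ (short x fx) (short x fx) ⟩
    w + w ∎
    where open ≤-Reasoning

  -- Agreement in the left half makes `left z′` satisfy the term of `left z`. Hence f is 1 there
  -- too, and by unambiguity the two terms coincide; agreement in the right half then gives the same
  -- disjunction.
  g-agree : ∀ z z′ → f (left z) ≡ true → AgreeOn (readVars (left z)) z z′ → g z′ ≡ g z
  g-agree z z′ fz agree = begin
    g z′                                               ≡⟨ g-value z′ (implies (left z) (left z′) fz sat) ⟩
    just (any (lookup (right z′)) (vars (left z′)))    ≡⟨ cong (just ∘ any (lookup (right z′)) ∘ map proj₁)
                                                            (unique (left z) (left z′) fz sat) ⟩
    just (any (lookup (right z′)) (vars (left z)))     ≡⟨ cong (just ∘ or) (map-cong-local (All.tabulate agreeʳ)) ⟩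
    just (any (lookup (right z)) (vars (left z)))      ≡⟨ g-value z fz ⟨
    g z                                                ∎
    where
    open ≡-Reasoning
    agreeˡ : AgreeOn (vars (left z)) (left z) (left z′)
    agreeˡ {i} i∈ = trans (lookup∘tabulate _ i)
      (trans (agree (∈-++⁺ˡ (∈-map⁺ (_↑ˡ n) i∈))) (sym (lookup∘tabulate _ i)))
    agreeʳ : AgreeOn (vars (left z)) (right z) (right z′)
    agreeʳ {i} i∈ = trans (lookup∘tabulate _ i)
      (trans (agree (∈-++⁺ʳ (map (_↑ˡ n) (vars (left z))) (∈-map⁺ (n ↑ʳ_) i∈))) (sym (lookup∘tabulate _ i)))
    sat : Satisfies (left z′) (term (left z))
    sat = satisfies-agree (left z) (left z′) fz agreeˡ

  C-at-g≤ : ∀ {S} z → f (left z) ≡ true → g z ∈ S → C-at S g z ≤ w + w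
  C-at-g≤ {S} z fz gz∈ = ≤-trans
    (C-at≤length g z (readVars (left z)) λ z′ agree → subst (_∈ S) (sym (g-agree z z′ fz agree)) gz∈)
    (length-readVars (left z) fz)

  C-g≤ : C g ≤ w + w
  C-g≤ = ⊔-lub
    (C-on≤ g λ { z (here eq) → C-at-g≤ z (g-defined z eq) (here eq) })
    (C-on≤ g λ { z (here eq) → C-at-g≤ z (g-defined z eq) (here eq) })

  -- The lower bound at z.

  module _ (x₀ : Input n) (fx₀ : f x₀ ≡ false) where

    𝟘 : Input n
    𝟘 = replicate n false

    z₀ : Input (n + n)
    z₀ = x₀ Vec.++ 𝟘

    g-z₀ : g z₀ ≡ nothing
    g-z₀ rewrite left-++ x₀ 𝟘 | fx₀ = refl

    -- One `x` in f⁻¹(1) that matches `x₀` on the touched indices makes both values of g attainable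
    -- without changing `z₀` on `ws`: only the choice of b differs.
    reach : ∀ c {ws} x → f x ≡ true → AgreeOn (map fold ws) x₀ x →
      ∃[ z ] (AgreeOn ws z₀ z × g z ≡ just c)
    reach false x fx agree =
      x Vec.++ 𝟘 , ++-agree x₀ x 𝟘 𝟘 agree (λ _ → refl) ,
      trans (g-++ x 𝟘 fx) (cong just (any-false⁺ {as = vars x} (All.tabulate λ {i} _ → lookup-replicate i false)))
    reach true {ws} x fx agree =
      x Vec.++ b , ++-agree x₀ x 𝟘 b agree agreeᵇ , trans (g-++ x b fx) (cong just any-true)
      where
      touched? : ∀ i → Dec (i ∈ map fold ws)
      touched? i = any? (i ≟ᶠ_) (map fold ws)

      b : Input n
      -- As many ones as possible: 0 exactly on the touched indices, where `𝟘` must be matched.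
      b = tabulate λ i → not (does (touched? i))

      agreeᵇ : AgreeOn (map fold ws) 𝟘 b
      agreeᵇ {i} i∈ = trans (lookup∘tabulate _ i)
        (trans (cong not (dec-true (touched? i) i∈)) (sym (lookup-replicate i false)))

      b-false⇒touched : ∀ {i} → lookup b i ≡ false → i ∈ map fold ws
      b-false⇒touched {i} bi = does-true (touched? i) (not-injective (trans (sym (lookup∘tabulate _ i)) bi))

      any-true : any (lookup b) (vars x) ≡ true
      any-true with any (lookup b) (vars x) in eq
      ... | true  = refl
      -- If b vanishes on all variables of the term of `x`, they are all touched, so `x₀` agrees
      -- with `x` there and satisfies that term, contradicting f(x₀) = 0.
      ... | false = contradiction
        (trans (sym fx₀) (implies x x₀ fx (satisfies-agree x x₀ fx λ i∈ →
          sym (agree (b-false⇒touched (All.lookup (any-false⁻ (vars x) eq) i∈))))))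
        λ ()

    -- If `ws` certifies membership in `S` at `z₀`, no `x` in f⁻¹(1) may agree with `x₀` on the
    -- folded list, since `reach` would produce the excluded value `c`. So the folded list is a
    -- 0-certificate for `x₀`.
    ≤C-at-z₀ : ∀ {S} c → just c ∉ S → C-at ⟨0⟩ (toPartial f) x₀ ≤ C-at S g z₀
    ≤C-at-z₀ {S} c c∉ = ≤C-at g z₀ (≤-trans (C-at≤arity (toPartial f) x₀) (m≤m+n n n)) λ ws det →
      subst (C-at ⟨0⟩ (toPartial f) x₀ ≤_) (length-map (fold {n}) ws)
        (C-at≤length (toPartial f) x₀ (map fold ws) λ x agree → here (cong just (f-false ws det x agree)))
      where
      f-false : ∀ ws → Determines g z₀ S ws → ∀ x → AgreeOn (map fold ws) x₀ x → f x ≡ false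
      f-false ws det x agree with f x in fx
      ... | false = refl
      ... | true with z , agree′ , gz ← reach c x fx agree =
        contradiction (subst (_∈ S) gz (det z agree′)) c∉

theorem2p2 : ∀ (n : ℕ) (f : TotalFn n) → (∃[ x ] f x ≡ false) →
    ∃[ g ] ∃[ z ] (g z ≡ nothing
    × (C-at {2 * n} ⟨not0⟩ g z ⊓ C-at ⟨not1⟩ g z) ≥ C-on ⟨0⟩ (toPartial f)
    × C g ≤ 2 * UC₁ f)
theorem2p2 n f (x , fx) with C-on-attained {S = ⟨0⟩} (toPartial f) x (here (cong just fx))
-- `2 * n` computes to `n + (n + 0)`, so the result for `n + n` is transported. The excluded values
-- are 0 for `⟨not0⟩` and 1 for `⟨not1⟩`.
... | x₀ , here eq , attained = subst Goal (cong (n +_) (sym (+-identityʳ n)))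
  ( g , z₀ x₀ fx₀ , g-z₀ x₀ fx₀
  , ⊓-glb (≤-trans attained (≤C-at-z₀ x₀ fx₀ false λ { (there (here ())) }))
          (≤-trans attained (≤C-at-z₀ x₀ fx₀ true λ { (there (here ())) }))
  , ≤-trans C-g≤ (≤-reflexive (cong (UC₁ f +_) (sym (+-identityʳ (UC₁ f)))))
  )
  where
  open Construction f (unambiguousTerms f)
  fx₀ : f x₀ ≡ false
  fx₀ = just-injective eq
  Goal : ℕ → Set
  Goal m = ∃[ g ] ∃[ z ] (g z ≡ nothing
    × (C-at {m} ⟨not0⟩ g z ⊓ C-at ⟨not1⟩ g z) ≥ C-on ⟨0⟩ (toPartial f)
    × C g ≤ 2 * UC₁ f)
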